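{- There is a constant $\epsilon>0$ such that for infinitely many positive integers $g$, there exists a graph of girth $6$ that is embeddable on a surface of Euler genus $g$ but is not $(0,0,\lceil \epsilon g\rceil)$-colorable.
   Context: All graphs are finite and simple (no loops, no multiple edges). For integers $d_1,\ldots,d_k$, a graph $G$ is $(d_1,\ldots,d_k)$-colorable if each vertex can be assigned a color from $\{1,\ldots,k\}$ such that for each $i$, every vertex colored $i$ has at most $d_i$ neighbors colored $i$. A surface is a non-null compact connected 2-manifold without boundary. The Euler genus of a surface is $2h$ if it is the orientable surface obtained from the sphere by adding $h\ge 0$ handles, and $k$ if it is the non-orientable surface obtained from the sphere by adding $k\ge 1$ cross-caps. -}

module Defs where

open import Algebra.Definitions using (Involutive)
open import Data.Bool.Base using (Bool; not)
open import Data.Fin.Base using (Fin; zero; suc; fromℕ; inject₁)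
open import Data.Fin.Properties using (_≟_)
open import Data.Integer.Base as ℤ using (ℤ; +_)
open import Data.List.Base using (allFin; filter; length)
open import Data.Nat.Base using (ℕ; suc; _≤_; _*_; NonZero)
open import Data.Product.Base using (_×_; ∃-syntax; Σ-syntax)
open import Data.Sum.Base using (_⊎_)
open import Data.Vec.Functional using (Vector)
open import Function.Bundles using (_⇔_)
open import Function.Definitions using (Injective; StrictlySurjective)
open import Level using (0ℓ)
open import Relation.Binary.Construct.Closure.ReflexiveTransitive using (Star)
open import Relation.Binary.Core using (Rel)
open import Relation.Binary.Definitions using (Decidable; Symmetric)
open import Relation.Binary.PropositionalEquality using (_≡_; _≢_)
open import Relation.Nullary using (¬_)
open import Relation.Nullary.Decidable using (_×-dec_)

------------------------------------------------------------------------
-- Finite simple graphs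

record Graph : Set₁ where
  field
    order    : ℕ
    _∼_      : Rel (Fin order) 0ℓ
    _∼?_     : Decidable _∼_
    ∼-sym    : Symmetric _∼_
    ∼-irrefl : ∀ v → ¬ (v ∼ v)

  Vertex : Set
  Vertex = Fin order

module _ (G : Graph) where
  open Graph G

  sameColourDegree : ∀ {k} → (Vertex → Fin k) → Vertex → ℕ
  sameColourDegree c v =
    length (filter (λ u → (v ∼? u) ×-dec (c u ≟ c v)) (allFin order))

  Colourable : ∀ {k} → Vector ℤ k → Set
  Colourable {k} d =
    ∃[ c ] (∀ (v : Vertex) → + sameColourDegree {k} c v ℤ.≤ d (c v))

  -- A cycle with 1 + m vertices, listed in cyclic order.
  record CycleOn (m : ℕ) : Set where
    field
      3≤length  : 3 ≤ suc m
      vertex    : Fin (suc m) → Vertex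
      injective : Injective _≡_ _≡_ vertex
      step      : ∀ (i : Fin m) → vertex (inject₁ i) ∼ vertex (suc i)
      close     : vertex (fromℕ m) ∼ vertex zero

  HasCycleOfLength : ℕ → Set
  HasCycleOfLength l = ∃[ m ] (l ≡ suc m × CycleOn m)

  HasGirth : ℕ → Set
  HasGirth l = HasCycleOfLength l × (∀ l′ → HasCycleOfLength l′ → l ≤ l′)

------------------------------------------------------------------------
-- Surfaces, up to homeomorphism

data Surface : Set where
  -- the sphere with h handles
  orientable    : (h : ℕ) → Surface
  -- the sphere with k ≥ 1 cross-caps
  nonorientable : (k : ℕ) → .{{NonZero k}} → Surface

eulerGenus : Surface → ℕ
eulerGenus (orientable h)    = 2 * h
eulerGenus (nonorientable k) = k

------------------------------------------------------------------------
-- Cell decompositions of closed surfaces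

-- The orbits of the group generated by two involutions σ and τ, numbered by
-- Fin count.  (σ and τ are their own inverses, so Star is symmetric.)
record Orbits {n : ℕ} (σ τ : Fin n → Fin n) : Set where
  field
    count      : ℕ
    orbit      : Fin n → Fin count
    surjective : StrictlySurjective _≡_ orbit
    exact      : ∀ f f′ →
                 orbit f ≡ orbit f′ ⇔
                 Star (λ x y → y ≡ σ x ⊎ y ≡ τ x) f f′

-- A cell decomposition of a closed connected surface (loops and parallel
-- edges allowed in its 1-skeleton), given by its flags, i.e. the triangles
-- of the barycentric subdivision.  The corners of a flag are a vertex, an
-- edge midpoint and a face centre, of dimensions 0, 1 and 2; αᵢ f is the
-- flag across the side of the triangle f opposite its i-dimensional corner,
-- so αᵢ changes only the i-dimensional cell.  As no αᵢ has a fixed point,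
-- every side lies in exactly two triangles and there is no boundary; as α₀ ∘
-- α₂ is a fixed-point-free involution, every edge is an arc or loop with two
-- ends and two sides.
record CellDecomposition : Set where
  field
    #flags : ℕ

  Flag : Set
  Flag = Fin #flags

  field
    someFlag  : Flag
    α₀ α₁ α₂  : Flag → Flag
    α₀-invol  : Involutive _≡_ α₀
    α₁-invol  : Involutive _≡_ α₁
    α₂-invol  : Involutive _≡_ α₂
    α₀-free   : ∀ f → α₀ f ≢ f
    α₁-free   : ∀ f → α₁ f ≢ f
    α₂-free   : ∀ f → α₂ f ≢ f
    α₀α₂-comm : ∀ f → α₀ (α₂ f) ≡ α₂ (α₀ f)
    α₀α₂-free : ∀ f → α₀ (α₂ f) ≢ f
    connected : ∀ f f′ →
                Star (λ x y → y ≡ α₀ x ⊎ y ≡ α₁ x ⊎ y ≡ α₂ x) f f′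
    vertices  : Orbits α₁ α₂
    edges     : Orbits α₀ α₂
    faces     : Orbits α₀ α₁

  open Orbits vertices public using () renaming (count to #V; orbit to vertexOf)
  open Orbits edges    public using () renaming (count to #E)
  open Orbits faces    public using () renaming (count to #F)

  eulerCharacteristic : ℤ
  eulerCharacteristic = + #V ℤ.- + #E ℤ.+ + #F

  -- The triangles can be coherently oriented: adjacent ones get opposite signs.
  Orientable : Set
  Orientable = Σ[ sign ∈ (Flag → Bool) ] (∀ f →
    sign (α₀ f) ≡ not (sign f) ×
    sign (α₁ f) ≡ not (sign f) ×
    sign (α₂ f) ≡ not (sign f))

open CellDecomposition

-- By the classification of surfaces, orientability and the Euler
-- characteristic determine the surface; a handle lowers the latter by 2 and a
-- cross-cap by 1.
_Decomposes_ : CellDecomposition → Surface → Set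
M Decomposes orientable h =
  Orientable M × eulerCharacteristic M ≡ + 2 ℤ.- + (2 * h)
M Decomposes nonorientable k =
  ¬ Orientable M × eulerCharacteristic M ≡ + 2 ℤ.- + k

-- G is a subgraph of the 1-skeleton.  Distinct edges of G automatically go to
-- distinct edges of M, because G is simple and vertexMap is injective.
record _SubgraphOf_ (G : Graph) (M : CellDecomposition) : Set where
  open Graph G
  field
    vertexMap : Vertex → Fin (#V M)
    injective : Injective _≡_ _≡_ vertexMap
    edgeFlag  : ∀ {u v} → u ∼ v →
                ∃[ f ] (vertexOf M f ≡ vertexMap u ×
                        vertexOf M (α₀ M f) ≡ vertexMap v)

-- The decomposition may have vertices and edges outside G, so G need not be
-- connected and its faces need not be discs: any drawing of G on the surface
-- extends to a cell decomposition with G in its 1-skeleton.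
_EmbedsIn_ : Graph → Surface → Set
G EmbedsIn S = ∃[ M ] (M Decomposes S × G SubgraphOf M)

{-# OPTIONS --safe #-}

-- Colourings.  Take seven disjoint 7-cycles, the hubs, and for every choice s
-- of one vertex from each hub add k further 7-cycles, the gadgets, whose i-th
-- vertex is joined to the chosen vertex of the i-th hub.  In a colouring with
-- d = (0, 0, q) every odd cycle has a vertex of the third colour.  If s
-- consists of such vertices of the hubs, each of the k gadgets of s gives a
-- chosen vertex a neighbour of the third colour, so k ≤ 7 q.
--
-- Girth.  A gadget vertex has a single neighbour in the hubs, so on a cycle
-- through hubs and gadgets every stretch of gadget vertices has length at
-- least 2.  The ends of a stretch are joined to different hubs, so there are
-- at least two stretches of gadget vertices and two of hub vertices.
--
-- Embedding.  A connected graph with n vertices and E edges lies on the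
-- boundary of its thickening in 3-space, the orientable surface with
-- E − n + 1 handles.  For the graphs above this number is linear in k.

module Submission where

open import Defs
open import Data.Integer.Base using (ℤ; +_; 0ℤ)
open import Data.Nat.Base using (ℕ; _<_)
open import Data.Product.Base using (_×_; ∃-syntax)
open import Data.Rational.Base as ℚ using (ℚ; 0ℚ; ceiling)
open import Data.Vec.Functional using (_∷_; [])
open import Relation.Binary.PropositionalEquality using (_≡_)
open import Relation.Nullary using (¬_)

open import Data.Bool.Base using (Bool; true; false; not)
open import Data.Bool.Properties as Bool using (not-involutive; not-¬; ¬-not)
open import Data.Empty using (⊥; ⊥-elim)
open import Data.Fin.Base
  using (Fin; zero; suc; combine; funToFin; finToFun; quotient; inject≤; inject₁; toℕ)
open import Data.Fin.Patterns
open import Data.Fin.Properties as Fin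
  using (_≟_; any?; all?; *↔×; +↔⊎; 2↔Bool; pigeonhole; ¬Fin0; nonZeroIndex;
         combine-injective; combine-injectiveʳ; inject≤-injective;
         remQuot-combine; finToFun-funToFin)
open import Data.Integer.Base as ℤ using ()
import Data.Integer.DivMod as ℤ
import Data.Integer.Properties as ℤ
import Data.Integer.Solver as ℤ-Solver
open import Data.List.Base using (List; allFin; filter; length; lookup)
open import Data.List.Membership.Propositional using (_∈_)
open import Data.List.Membership.Propositional.Properties using (∈-filter⁺; ∈-allFin)
open import Data.List.Relation.Unary.Any using (index)
open import Data.List.Relation.Unary.Any.Properties using (lookup-index)
open import Data.Nat.Base as ℕ using (zero; suc; _+_; _*_; _^_; _≤_; z≤n; s≤s)
open import Data.Nat.Coprimality using (1-coprimeTo)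
open import Data.Nat.GeneralisedArithmetic using (fold)
import Data.Nat.Properties as ℕ
import Data.Nat.Solver as ℕ-Solver
open import Data.Product.Base using (_,_; proj₁; proj₂)
open import Data.Product.Function.NonDependent.Propositional using (_×-↔_)
open import Data.Rational.Base using (mkℚ; ↥_; ↧_)
import Data.Rational.Properties as ℚ
import Data.Rational.Unnormalised.Base as ℚᵘ
import Data.Rational.Unnormalised.Properties as ℚᵘ
open import Data.Sum.Base as Sum using (_⊎_; inj₁; inj₂)
open import Data.Sum.Function.Propositional using (_⊎-↔_)
open import Data.Sum.Properties using (inj₂-injective)
open import Function.Base using (_∘_; id)
open import Function.Bundles using (_↔_; Inverse; _⇔_; mk⇔; module Equivalence)
open import Function.Definitions using (Injective; StrictlySurjective)
open import Function.Properties.Inverse using (↔-refl; ↔-sym; ↔-trans)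
open import Relation.Binary.Construct.Closure.ReflexiveTransitive as Star
  using (Star; _◅_; _◅◅_; return)
open import Relation.Binary.Definitions using (Decidable; DecidableEquality; Symmetric)
open import Relation.Binary.PropositionalEquality
  using (_≢_; refl; sym; trans; cong; cong₂; subst; subst₂; ≢-sym; ≡-≟-identity;
         module ≡-Reasoning)
open import Relation.Nullary using (Dec; yes; no; contradiction)
open import Relation.Nullary.Decidable using (_×-dec_; _⊎-dec_; ¬?; toWitness; dec-no)
open import Relation.Unary using () renaming (Decidable to Decidable₁)

-- Rotations

-- A permutation of `A` whose cycles are the nonempty fibres of `f`. Applied to the tails of darts
-- it is a rotation system: a cyclic order of the darts around every vertex.
record Rotation {A B : Set} (f : A → B) : Set where
  field
    next prev : A → A
    next-prev : ∀ a → next (prev a) ≡ a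
    prev-next : ∀ a → prev (next a) ≡ a
    preserved : ∀ a → f (next a) ≡ f a
    reach     : ∀ {a b} → f a ≡ f b → Star (λ x y → y ≡ next x) a b

module _ {B : Set} (_≟ᴮ_ : DecidableEquality B) where

  private
    -- Splices `zero` into an existing cycle: `d` now leads to `zero`, and `zero` to the former
    -- successor of `d`.
    module Insert {n} (f : Fin (suc n) → B) (R : Rotation (f ∘ suc))
                  (d : Fin n) (fd≡f0 : f (suc d) ≡ f zero) where
      open Rotation R

      next⁺ : Fin (suc n) → Fin (suc n)
      next⁺ zero = suc (next d)
      next⁺ (suc x) with x ≟ d
      ... | yes _ = zero
      ... | no  _ = suc (next x)

      prev⁺ : Fin (suc n) → Fin (suc n)
      prev⁺ zero = suc d
      prev⁺ (suc y) with y ≟ next d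
      ... | yes _ = zero
      ... | no  _ = suc (prev y)

      next⁺-d : next⁺ (suc d) ≡ zero
      next⁺-d with d ≟ d
      ... | yes _  = refl
      ... | no d≢d = contradiction refl d≢d

      next⁺-suc : ∀ {x} → x ≢ d → next⁺ (suc x) ≡ suc (next x)
      next⁺-suc {x} x≢d with x ≟ d
      ... | yes x≡d = contradiction x≡d x≢d
      ... | no  _   = refl

      next⁺-prev⁺ : ∀ a → next⁺ (prev⁺ a) ≡ a
      next⁺-prev⁺ zero = next⁺-d
      next⁺-prev⁺ (suc y) with y ≟ next d
      ... | yes y≡ = cong suc (sym y≡)
      ... | no  y≢ = trans
        (next⁺-suc λ py≡d → y≢ (trans (sym (next-prev y)) (cong next py≡d)))
        (cong suc (next-prev y))

      prev⁺-next⁺ : ∀ a → prev⁺ (next⁺ a) ≡ a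
      prev⁺-next⁺ zero with next d ≟ next d
      ... | yes _ = refl
      ... | no  ≢ = contradiction refl ≢
      prev⁺-next⁺ (suc x) with x ≟ d
      ... | yes x≡d = cong suc (sym x≡d)
      ... | no  x≢d with next x ≟ next d
      ...   | yes nx≡nd = contradiction
        (trans (sym (prev-next x)) (trans (cong prev nx≡nd) (prev-next d))) x≢d
      ...   | no  _     = cong suc (prev-next x)

      preserved⁺ : ∀ a → f (next⁺ a) ≡ f a
      preserved⁺ zero = trans (preserved d) fd≡f0
      preserved⁺ (suc x) with x ≟ d
      ... | yes x≡d = trans (sym fd≡f0) (cong (f ∘ suc) (sym x≡d))
      ... | no  _   = preserved x

      -- A step out of `d` becomes two steps, by way of `zero`; all other steps survive.
      lift-path : ∀ {x y} → Star (λ x y → y ≡ next x) x y →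
                  Star (λ x y → y ≡ next⁺ x) (suc x) (suc y)
      lift-path Star.ε = Star.ε
      lift-path {x} (refl ◅ xs) with x ≟ d
      ... | yes refl = sym next⁺-d ◅ refl ◅ lift-path xs
      ... | no  x≢d  = sym (next⁺-suc x≢d) ◅ lift-path xs

      reach⁺ : ∀ {a b} → f a ≡ f b → Star (λ x y → y ≡ next⁺ x) a b
      reach⁺ {zero}  {zero}  _  = Star.ε
      reach⁺ {zero}  {suc y} eq =
        refl ◅ lift-path (reach (trans (preserved d) (trans fd≡f0 eq)))
      reach⁺ {suc x} {zero}  eq =
        lift-path (reach (trans eq (sym fd≡f0))) ◅◅ return (sym next⁺-d)
      reach⁺ {suc x} {suc y} eq = lift-path (reach eq)

      insert : Rotation f
      insert = record
        { next = next⁺ ; prev = prev⁺ ; next-prev = next⁺-prev⁺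
        ; prev-next = prev⁺-next⁺ ; preserved = preserved⁺ ; reach = reach⁺ }

    -- The fibre of `zero` is a singleton here, so `zero` becomes a fixed point.
    module Adjoin {n} (f : Fin (suc n) → B) (R : Rotation (f ∘ suc))
                  (new : ∀ d → f (suc d) ≢ f zero) where
      open Rotation R

      next⁺ prev⁺ : Fin (suc n) → Fin (suc n)
      next⁺ zero    = zero
      next⁺ (suc x) = suc (next x)
      prev⁺ zero    = zero
      prev⁺ (suc y) = suc (prev y)

      reach⁺ : ∀ {a b} → f a ≡ f b → Star (λ x y → y ≡ next⁺ x) a b
      reach⁺ {zero}  {zero}  _  = Star.ε
      reach⁺ {zero}  {suc y} eq = contradiction (sym eq) (new y)
      reach⁺ {suc x} {zero}  eq = contradiction eq (new x)
      reach⁺ {suc x} {suc y} eq = Star.gmap suc (cong suc) (reach eq)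

      adjoin : Rotation f
      adjoin = record
        { next = next⁺ ; prev = prev⁺
        ; next-prev = λ { zero → refl ; (suc y) → cong suc (next-prev y) }
        ; prev-next = λ { zero → refl ; (suc x) → cong suc (prev-next x) }
        ; preserved = λ { zero → refl ; (suc x) → preserved x }
        ; reach = reach⁺ }

  rotationFin : ∀ {n} (f : Fin n → B) → Rotation f
  rotationFin {zero} f = record
    { next = id ; prev = id ; next-prev = λ () ; prev-next = λ ()
    ; preserved = λ () ; reach = λ { {()} } }
  rotationFin {suc n} f with any? (λ d → f (suc d) ≟ᴮ f zero)
  ... | yes (d , eq) = Insert.insert f (rotationFin (f ∘ suc)) d eq
  ... | no  ∄d       = Adjoin.adjoin f (rotationFin (f ∘ suc)) λ d eq → ∄d (d , eq)

  rotation : ∀ {A : Set} {n} → A ↔ Fin n → (f : A → B) → Rotation f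
  rotation A↔ f = record
    { next = from ∘ next ∘ to
    ; prev = from ∘ prev ∘ to
    ; next-prev = λ a → trans (cong (from ∘ next) (strictlyInverseˡ _))
                              (trans (cong from (next-prev (to a))) (strictlyInverseʳ a))
    ; prev-next = λ a → trans (cong (from ∘ prev) (strictlyInverseˡ _))
                              (trans (cong from (prev-next (to a))) (strictlyInverseʳ a))
    ; preserved = λ a → trans (preserved (to a)) (cong f (strictlyInverseʳ a))
    ; reach = λ {a} {b} eq → subst₂ (Star _) (strictlyInverseʳ a) (strictlyInverseʳ b)
        (Star.gmap from
          (λ y≡ → cong from (trans y≡ (cong next (sym (strictlyInverseˡ _)))))
          (reach (subst₂ (λ x y → f x ≡ f y)
            (sym (strictlyInverseʳ a)) (sym (strictlyInverseʳ b)) eq)))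
    }
    where
    open Inverse A↔
    open Rotation (rotationFin (f ∘ from))

-- Cell decompositions with flags in a finite type

Generated : {A : Set} (σ τ : A → A) → A → A → Set
Generated σ τ x y = y ≡ σ x ⊎ y ≡ τ x

Labels : {A : Set} (σ τ : A → A) {count : ℕ} → (A → Fin count) → Set
Labels σ τ orbit = ∀ a b → orbit a ≡ orbit b ⇔ Star (Generated σ τ) a b

labels : ∀ {A : Set} {σ τ : A → A} {count} {orbit : A → Fin count} →
         (∀ a → orbit (σ a) ≡ orbit a) → (∀ a → orbit (τ a) ≡ orbit a) →
         (∀ {a b} → orbit a ≡ orbit b → Star (Generated σ τ) a b) →
         Labels σ τ orbit
labels {σ = σ} {τ} {orbit = orbit} σ-inv τ-inv path a b = mk⇔ path constant
  where
  constant : ∀ {a b} → Star (Generated σ τ) a b → orbit a ≡ orbit b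
  constant Star.ε           = refl
  constant (inj₁ refl ◅ xs) = trans (sym (σ-inv _)) (constant xs)
  constant (inj₂ refl ◅ xs) = trans (sym (τ-inv _)) (constant xs)

-- Flags have to be numbered by `Fin`, but are easier to handle as a product type. The involutions
-- and orbits are built there and conjugated along the bijection.
module Transport {A : Set} {n : ℕ} (A↔ : A ↔ Fin n) where
  open Inverse A↔ public using (to; from; strictlyInverseˡ; strictlyInverseʳ)

  conj : (A → A) → Fin n → Fin n
  conj σ = to ∘ σ ∘ from

  conj-to : ∀ σ a → conj σ (to a) ≡ to (σ a)
  conj-to σ a = cong (to ∘ σ) (strictlyInverseʳ a)

  from-injective : ∀ {x y} → from x ≡ from y → x ≡ y
  from-injective {x} {y} eq =
    trans (sym (strictlyInverseˡ x)) (trans (cong to eq) (strictlyInverseˡ y))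

  to-injective : ∀ {a b} → to a ≡ to b → a ≡ b
  to-injective {a} {b} eq =
    trans (sym (strictlyInverseʳ a)) (trans (cong from eq) (strictlyInverseʳ b))

  conj-invol : ∀ σ → (∀ a → σ (σ a) ≡ a) → ∀ x → conj σ (conj σ x) ≡ x
  conj-invol σ invol x =
    trans (conj-to σ _) (trans (cong to (invol (from x))) (strictlyInverseˡ x))

  conj-free : ∀ σ → (∀ a → σ a ≢ a) → ∀ x → conj σ x ≢ x
  conj-free σ free x eq = free (from x) (trans (sym (strictlyInverseʳ _)) (cong from eq))

  conj-path : ∀ {R : A → A → Set} {S : Fin n → Fin n → Set} →
              (∀ {a b} → R a b → S (to a) (to b)) →
              ∀ {x y} → Star R (from x) (from y) → Star S x y
  conj-path step {x} {y} p = subst₂ (Star _) (strictlyInverseˡ x) (strictlyInverseˡ y)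
    (Star.gmap to step p)

  conj-step : ∀ σ {a b} → b ≡ σ a → to b ≡ conj σ (to a)
  conj-step σ {a} eq = trans (cong to eq) (sym (conj-to σ a))

  conj-orbits : ∀ {σ τ count} {orbit : A → Fin count} →
                StrictlySurjective _≡_ orbit → Labels σ τ orbit →
                Orbits (conj σ) (conj τ)
  conj-orbits {σ} {τ} {count} {orbit} surj exact = record
    { count = count
    ; orbit = orbit ∘ from
    ; surjective = λ i → let a , eq = surj i in
        to a , trans (cong orbit (strictlyInverseʳ a)) eq
    ; exact = λ x y → let module E = Equivalence (exact (from x) (from y)) in mk⇔
        (conj-path (Sum.map (conj-step σ) (conj-step τ)) ∘ E.to)
        (E.from ∘ Star.gmap from (Sum.map (from-step σ) (from-step τ)))
    }
    where
    from-step : ∀ σ {x y} → y ≡ conj σ x → from y ≡ σ (from x)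
    from-step σ eq = trans (cong from eq) (strictlyInverseʳ _)

-- The surface of a thickened graph

Joined : ∀ {E n} → (Fin E → Bool → Fin n) → Fin n → Fin n → Set
Joined ends u v = ∃[ e ] ∃[ b ] (ends e b ≡ u × ends e (not b) ≡ v)

-- The boundary of the thickening consists of a punctured sphere for every
-- vertex and a tube for every edge.  Two parallel edges along each tube cut it
-- into two strips.  Attaching one strip to each of the two punctured spheres
-- at the ends of the tube gives one face for every vertex.

module Handlebody
  {E n h : ℕ} (ends : Fin E → Bool → Fin n)
  (covered : ∀ v → ∃[ e ] ∃[ b ] ends e b ≡ v)
  (root : Fin n)
  (connected : ∀ v → Star (Joined ends) v root)
  (count : suc E ≡ h + n)
  where

  Dart = Fin E × Bool

  tail : Dart → Fin n
  tail (e , b) = ends e b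

  rev : Dart → Dart
  rev (e , b) = e , not b

  rev-invol : ∀ d → rev (rev d) ≡ d
  rev-invol (e , b) = cong (e ,_) (not-involutive b)

  Dart↔ : Dart ↔ Fin (E * 2)
  Dart↔ = ↔-trans (↔-refl ×-↔ ↔-sym 2↔Bool) (↔-sym *↔×)

  open Rotation (rotation _≟_ Dart↔ tail)

  -- Every edge of the graph carries two parallel edges of the surface, told
  -- apart by the first Boolean; the second one tells their two sides apart.
  -- The four flags of a dart follow each other around its tail in the order
  -- ff, ft, tf, tt.
  Flag = Dart × Bool × Bool

  pattern ff = false , false
  pattern ft = false , true
  pattern tf = true , false
  pattern tt = true , true

  Flag↔ : Flag ↔ Fin (E * 2 * 4)
  Flag↔ = ↔-trans
    (Dart↔ ×-↔ ↔-trans (↔-sym 2↔Bool ×-↔ ↔-sym 2↔Bool) (↔-sym *↔×))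
    (↔-sym *↔×)

  -- The side `y` is read from the tail, so the same side has the other `y` when read from the far
  -- end. Keeping `x` under `a₀` sends the corner between the two edges of a dart to corners between
  -- successive darts at the far end; flipping `x` too would make the two edges bound a digon.
  a₀ a₁ a₂ : Flag → Flag
  a₀ (d , x , y) = rev d , x , not y
  a₁ (d , ff)    = prev d , tt
  a₁ (d , ft)    = d , tf
  a₁ (d , tf)    = d , ft
  a₁ (d , tt)    = next d , ff
  a₂ (d , x , y) = d , x , not y

  a₀-invol : ∀ f → a₀ (a₀ f) ≡ f
  a₀-invol (d , x , y) = cong₂ (λ d y → d , x , y) (rev-invol d) (not-involutive y)

  a₁-invol : ∀ f → a₁ (a₁ f) ≡ f
  a₁-invol (d , ff) = cong (_, ff) (next-prev d)
  a₁-invol (d , ft) = refl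
  a₁-invol (d , tf) = refl
  a₁-invol (d , tt) = cong (_, tt) (prev-next d)

  a₂-invol : ∀ f → a₂ (a₂ f) ≡ f
  a₂-invol (d , x , y) = cong (λ y → d , x , y) (not-involutive y)

  -- All three involutions flip `y`. This orients the surface and also excludes fixed points.
  sign : Flag → Bool
  sign (d , x , y) = y

  sign-a₁ : ∀ f → sign (a₁ f) ≡ not (sign f)
  sign-a₁ (d , ff) = refl
  sign-a₁ (d , ft) = refl
  sign-a₁ (d , tf) = refl
  sign-a₁ (d , tt) = refl

  sign-reversing-free : ∀ (σ : Flag → Flag) → (∀ f → sign (σ f) ≡ not (sign f)) →
                        ∀ f → σ f ≢ f
  sign-reversing-free σ reverses f eq = not-¬ (cong sign eq) (reverses f)

  -- The composite preserves `sign`, but it reverses the dart.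
  a₀a₂-free : ∀ f → a₀ (a₂ f) ≢ f
  a₀a₂-free ((e , b) , _) eq = not-¬ refl (sym (cong (proj₂ ∘ proj₁) eq))

  vertex : Flag → Fin n
  vertex (d , p) = tail d

  vertex-a₁ : ∀ f → vertex (a₁ f) ≡ vertex f
  vertex-a₁ (d , ff) = trans (sym (preserved _)) (cong tail (next-prev d))
  vertex-a₁ (d , ft) = refl
  vertex-a₁ (d , tf) = refl
  vertex-a₁ (d , tt) = preserved d

  vertex-surjective : StrictlySurjective _≡_ vertex
  vertex-surjective v = let e , b , eq = covered v in ((e , b) , ff) , eq

  fan : ∀ d p → Star (Generated a₁ a₂) (d , ff) (d , p)
  fan d ff = Star.ε
  fan d ft = inj₂ refl ◅ Star.ε
  fan d tf = inj₂ refl ◅ inj₁ refl ◅ Star.ε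
  fan d tt = inj₂ refl ◅ inj₁ refl ◅ inj₂ refl ◅ Star.ε

  generated-sym : ∀ {σ τ : Flag → Flag} → (∀ f → σ (σ f) ≡ f) → (∀ f → τ (τ f) ≡ f) →
                  ∀ {f f′} → Generated σ τ f f′ → Generated σ τ f′ f
  generated-sym σ-invol τ-invol (inj₁ refl) = inj₁ (sym (σ-invol _))
  generated-sym σ-invol τ-invol (inj₂ refl) = inj₂ (sym (τ-invol _))

  -- The fan of a dart leads from `ff` to `tt`, and `a₁` from there to `ff` of the next dart. So
  -- each step of the rotation lifts to a path of flags.
  vertex-path : ∀ {f f′} → vertex f ≡ vertex f′ → Star (Generated a₁ a₂) f f′
  vertex-path {d , p} {d′ , p′} eq =
    Star.reverse (generated-sym a₁-invol a₂-invol) (fan d p)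
    ◅◅ Star.kleisliStar (_, ff) (λ { refl → fan _ tt ◅◅ return (inj₁ refl) }) (reach eq)
    ◅◅ fan d′ p′

  -- `Dart` serves only as the type `Fin E × Bool` here: the Boolean is `x`, which of the two
  -- parallel edges is meant, and not a direction.
  edge : Flag → Dart
  edge ((e , b) , x , y) = e , x

  edge-path : ∀ {f f′} → edge f ≡ edge f′ → Star (Generated a₀ a₂) f f′
  edge-path {(e , b) , x , y} {(_ , b′) , _ , y′} refl with b Bool.≟ b′ | y Bool.≟ y′
  ... | yes refl | yes refl = Star.ε
  ... | yes refl | no y≢y′ with refl ← ¬-not (y≢y′ ∘ sym) = return (inj₂ refl)
  ... | no b≢b′ | no y≢y′
    with refl ← ¬-not (b≢b′ ∘ sym) | refl ← ¬-not (y≢y′ ∘ sym) = return (inj₁ refl)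
  ... | no b≢b′ | yes refl with refl ← ¬-not (b≢b′ ∘ sym) =
    inj₁ refl ◅ return (inj₂ (sym (a₂-invol _)))

  -- Of the two strips of a tube, the one meeting the tail of `d` between the two edges of `d`
  -- belongs to the sphere at the far end.
  face : Flag → Fin n
  face (d , ff) = tail d
  face (d , ft) = tail (rev d)
  face (d , tf) = tail (rev d)
  face (d , tt) = tail d

  face-a₀ : ∀ f → face (a₀ f) ≡ face f
  face-a₀ (d , ff) = cong tail (rev-invol d)
  face-a₀ (d , ft) = refl
  face-a₀ (d , tf) = refl
  face-a₀ (d , tt) = cong tail (rev-invol d)

  face-a₁ : ∀ f → face (a₁ f) ≡ face f
  face-a₁ (d , ff) = vertex-a₁ (d , ff)
  face-a₁ (d , ft) = refl
  face-a₁ (d , tf) = refl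
  face-a₁ (d , tt) = preserved d

  face-surjective : StrictlySurjective _≡_ face
  face-surjective v = let e , b , eq = covered v in ((e , b) , ff) , eq

  -- Runs along one edge of the tube to the far end, turns between the two edges there, and comes
  -- back along the other one.
  strip : ∀ d → Star (Generated a₀ a₁) (d , ff) (d , tt)
  strip d = inj₁ refl ◅ inj₂ refl ◅ return (inj₁ (cong (_, tt) (sym (rev-invol d))))

  side : Flag → Dart
  side (d , ff) = d
  side (d , ft) = rev d
  side (d , tf) = rev d
  side (d , tt) = d

  face-side : ∀ f → face f ≡ tail (side f)
  face-side (d , ff) = refl
  face-side (d , ft) = refl
  face-side (d , tf) = refl
  face-side (d , tt) = refl

  to-side : ∀ f → Star (Generated a₀ a₁) f (side f , ff)
  to-side (d , ff) = Star.ε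
  to-side (d , ft) = return (inj₁ refl)
  to-side (d , tf) = inj₂ refl ◅ return (inj₁ refl)
  to-side (d , tt) = Star.reverse (generated-sym a₀-invol a₁-invol) (strip d)

  -- Every flag is first moved to the `ff` flag of the dart whose strip contains it. From there the
  -- boundary of the face alternates between running around a strip and passing to the next dart.
  face-path : ∀ {f f′} → face f ≡ face f′ → Star (Generated a₀ a₁) f f′
  face-path {f} {f′} eq =
    to-side f
    ◅◅ Star.kleisliStar (_, ff) (λ { refl → strip _ ◅◅ return (inj₂ refl) })
         (reach (trans (sym (face-side f)) (trans eq (face-side f′))))
    ◅◅ Star.reverse (generated-sym a₀-invol a₁-invol) (to-side f′)

  Adjacent : Flag → Flag → Set
  Adjacent f f′ = f′ ≡ a₀ f ⊎ f′ ≡ a₁ f ⊎ f′ ≡ a₂ f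

  adjacent-sym : ∀ {f f′} → Adjacent f f′ → Adjacent f′ f
  adjacent-sym (inj₁ refl)        = inj₁ (sym (a₀-invol _))
  adjacent-sym (inj₂ (inj₁ refl)) = inj₂ (inj₁ (sym (a₁-invol _)))
  adjacent-sym (inj₂ (inj₂ refl)) = inj₂ (inj₂ (sym (a₂-invol _)))

  rootFlag : Flag
  rootFlag = proj₁ (vertex-surjective root)

  -- A walk in the graph lifts to flags: turn around the vertex to the required dart, then cross to
  -- its other end by `a₀`.
  to-root : ∀ {v} → Star (Joined ends) v root → ∀ f → vertex f ≡ v → Star Adjacent f rootFlag
  to-root Star.ε f eq =
    Star.map inj₂ (vertex-path (trans eq (sym (proj₂ (vertex-surjective root)))))
  to-root ((e , b , eq₁ , eq₂) ◅ xs) f eq =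
    Star.map inj₂ (vertex-path {f} {(e , b) , ff} (trans eq (sym eq₁)))
    ◅◅ inj₁ refl ◅ to-root xs _ eq₂

  flags-connected : ∀ f f′ → Star Adjacent f f′
  flags-connected f f′ =
    to-root (connected _) f refl
    ◅◅ Star.reverse adjacent-sym (to-root (connected _) f′ refl)

  open Transport Flag↔
  module D = Inverse Dart↔

  surface : CellDecomposition
  surface = record
    { #flags = E * 2 * 4
    ; someFlag = to rootFlag
    ; α₀ = conj a₀ ; α₁ = conj a₁ ; α₂ = conj a₂
    ; α₀-invol = conj-invol a₀ a₀-invol
    ; α₁-invol = conj-invol a₁ a₁-invol
    ; α₂-invol = conj-invol a₂ a₂-invol
    ; α₀-free = conj-free a₀ (sign-reversing-free a₀ λ _ → refl)
    ; α₁-free = conj-free a₁ (sign-reversing-free a₁ sign-a₁)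
    ; α₂-free = conj-free a₂ (sign-reversing-free a₂ λ _ → refl)
    ; α₀α₂-comm = λ f → trans (conj-to a₀ (a₂ (from f))) (sym (conj-to a₂ (a₀ (from f))))
    ; α₀α₂-free = λ f eq → conj-free (a₀ ∘ a₂) a₀a₂-free f
        (trans (sym (conj-to a₀ (a₂ (from f)))) eq)
    ; connected = λ f f′ → conj-path
        (Sum.map (conj-step a₀) (Sum.map (conj-step a₁) (conj-step a₂)))
        (flags-connected (from f) (from f′))
    ; vertices = conj-orbits vertex-surjective
        (labels vertex-a₁ (λ _ → refl) vertex-path)
    ; edges = conj-orbits {orbit = D.to ∘ edge}
        (λ i → let e , x = D.from i in ((e , true) , x , true) , D.strictlyInverseˡ i)
        (labels (λ _ → refl) (λ _ → refl) (edge-path ∘ Transport.to-injective Dart↔))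
    ; faces = conj-orbits face-surjective (labels face-a₀ face-a₁ face-path)
    }

  orientation : CellDecomposition.Orientable surface
  orientation = sign ∘ from , λ x →
    reverses a₀ (λ _ → refl) x , reverses a₁ sign-a₁ x , reverses a₂ (λ _ → refl) x
    where
    reverses : ∀ σ → (∀ f → sign (σ f) ≡ not (sign f)) →
               ∀ x → sign (from (conj σ x)) ≡ not (sign (from x))
    reverses σ eq x = trans (cong sign (strictlyInverseʳ (σ (from x)))) (eq (from x))

  -- With `n` vertices, `E * 2` edges and `n` faces the characteristic is 2(n - E), and by `count` n
  -- - E = 1 - h.
  euler : + n ℤ.- + (E * 2) ℤ.+ + n ≡ + 2 ℤ.- + (2 * h)
  euler = begin
    + n ℤ.- + (E * 2) ℤ.+ + n          ≡⟨ cong (λ x → + n ℤ.- x ℤ.+ + n) (ℤ.pos-* E 2) ⟩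
    + n ℤ.- + E ℤ.* + 2 ℤ.+ + n        ≡⟨ solve 2 (λ n e →
      n :- e :* con (+ 2) :+ n := con (+ 2) :- con (+ 2) :* ((con (+ 1) :+ e) :- n))
      refl (+ n) (+ E) ⟩
    + 2 ℤ.- + 2 ℤ.* (+ suc E ℤ.- + n)  ≡⟨ cong (λ x → + 2 ℤ.- + 2 ℤ.* (+ x ℤ.- + n)) count ⟩
    + 2 ℤ.- + 2 ℤ.* (+ h ℤ.+ + n ℤ.- + n) ≡⟨ solve 2 (λ n h →
      con (+ 2) :- con (+ 2) :* (h :+ n :- n) := con (+ 2) :- con (+ 2) :* h)
      refl (+ n) (+ h) ⟩
    + 2 ℤ.- + 2 ℤ.* + h                ≡⟨ cong (λ x → + 2 ℤ.- x) (ℤ.pos-* 2 h) ⟨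
    + 2 ℤ.- + (2 * h)                  ∎
    where
    open ≡-Reasoning
    open ℤ-Solver.+-*-Solver

  decomposes : surface Decomposes orientable h
  decomposes = orientation , euler

thickening : (G : Graph) → let open Graph G in
  ∀ {E h} (ends : Fin E → Bool → Vertex) →
  (∀ {u v} → u ∼ v → Joined ends u v) →
  (∀ v → ∃[ u ] (v ∼ u)) → (root : Vertex) → (∀ v → Star _∼_ v root) →
  suc E ≡ h + order → G EmbedsIn orientable h
thickening G {h = h} ends cover neighbour root connected count =
  surface , decomposes , record
    { vertexMap = id
    ; injective = id
    ; edgeFlag  = λ u∼v → let e , b , eq₁ , eq₂ = cover u∼v in
        -- Of the two parallel edges that carry `e`, the one with `x = false` represents it.
        to ((e , b) , ff) ,
        trans (cong vertex (strictlyInverseʳ ((e , b) , ff))) eq₁ ,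
        trans (cong vertex (trans (strictlyInverseʳ _)
                                  (cong a₀ (strictlyInverseʳ ((e , b) , ff))))) eq₂
    }
  where
  covered : ∀ v → ∃[ e ] ∃[ b ] ends e b ≡ v
  covered v =
    let _ , v∼u = neighbour v
        e , b , eq , _ = cover v∼u
    in e , b , eq

  joined : ∀ v → Star (Joined ends) v root
  joined v = Star.map cover (connected v)

  open Handlebody {h = h} ends covered root joined count
  open Transport Flag↔

-- The cycle of length 7

turn : Fin 7 → Fin 7
turn 0F = 1F
turn 1F = 2F
turn 2F = 3F
turn 3F = 4F
turn 4F = 5F
turn 5F = 6F
turn 6F = 0F

Linked : Fin 7 → Fin 7 → Set
Linked i j = j ≡ turn i ⊎ i ≡ turn j

linked? : Decidable Linked
linked? i j = (j ≟ turn i) ⊎-dec (i ≟ turn j)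

turn-injective : ∀ {i j} → turn i ≡ turn j → i ≡ j
turn-injective {i} {j} eq = trans (sym (turn⁷ i)) (trans (cong turn⁶ eq) (turn⁷ j))
  where
  turn⁶ : Fin 7 → Fin 7
  turn⁶ = turn ∘ turn ∘ turn ∘ turn ∘ turn ∘ turn

  turn⁷ : ∀ i → turn⁶ (turn i) ≡ i
  turn⁷ = toWitness {a? = all? λ i → turn⁶ (turn i) ≟ i} _

-- The other neighbour of `j` is `i`, since `turn` is injective; not going back to `i` means keeping
-- the direction.
onwards : ∀ {i j k} → j ≡ turn i → Linked j k → i ≢ k → k ≡ turn j
onwards _    (inj₁ k≡) _   = k≡
onwards refl (inj₂ eq) i≢k = contradiction (turn-injective eq) i≢k

linked-irrefl : ∀ i → ¬ Linked i i
linked-irrefl i = Sum.[ no-loop i , no-loop i ]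
  where
  no-loop : ∀ i → i ≢ turn i
  no-loop = toWitness {a? = all? λ i → ¬? (i ≟ turn i)} _

linked-sym : Symmetric Linked
linked-sym = Sum.swap

-- A closed walk without backtracking never changes direction, so its length
-- is a multiple of 7.

loop₃ : ∀ {i k} → Linked (turn i) k → Linked k i → i ≢ k → turn i ≢ i → ⊥
loop₃ {i} jk ki i≢k j≢i
  with refl ← onwards refl jk i≢k
  with eq ← onwards refl ki j≢i = no-fixed i eq
  where
  no-fixed : ∀ i → i ≢ turn (turn (turn i))
  no-fixed = toWitness {a? = all? λ i → ¬? (i ≟ turn (turn (turn i)))} _

-- If the first step goes backwards, the reversed walk starting at `j` has a forward first step.
closed₃ : ∀ {i j k} → Linked i j → Linked j k → Linked k i → i ≢ k → j ≢ i → k ≢ j → ⊥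
closed₃ (inj₁ refl) jk ki i≢k j≢i _ = loop₃ jk ki i≢k j≢i
closed₃ (inj₂ refl) jk ki _ j≢i k≢j =
  loop₃ (linked-sym ki) (linked-sym jk) (≢-sym k≢j) (≢-sym j≢i)

loop₄ : ∀ {i k l} → Linked (turn i) k → Linked k l → Linked l i →
        i ≢ k → turn i ≢ l → ⊥
loop₄ {i} jk kl li i≢k j≢l
  with refl ← onwards refl jk i≢k
  with refl ← onwards refl kl j≢l
  with eq ← onwards refl li (≢-sym i≢k) = no-fixed i eq
  where
  no-fixed : ∀ i → i ≢ turn (turn (turn (turn i)))
  no-fixed = toWitness {a? = all? λ i → ¬? (i ≟ turn (turn (turn (turn i))))} _

closed₄ : ∀ {i j k l} → Linked i j → Linked j k → Linked k l → Linked l i →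
          i ≢ k → j ≢ l → ⊥
closed₄ (inj₁ refl) jk kl li i≢k j≢l = loop₄ jk kl li i≢k j≢l
closed₄ (inj₂ refl) jk kl li i≢k j≢l =
  loop₄ (linked-sym li) (linked-sym kl) (linked-sym jk) j≢l i≢k

loop₅ : ∀ {i k l m} → Linked (turn i) k → Linked k l → Linked l m → Linked m i →
        i ≢ k → turn i ≢ l → k ≢ m → l ≢ i → ⊥
loop₅ {i} jk kl lm mi i≢k j≢l k≢m l≢i
  with refl ← onwards refl jk i≢k
  with refl ← onwards refl kl j≢l
  with refl ← onwards refl lm k≢m
  with eq ← onwards refl mi l≢i = no-fixed i eq
  where
  no-fixed : ∀ i → i ≢ turn (turn (turn (turn (turn i))))
  no-fixed = toWitness {a? = all? λ i → ¬? (i ≟ turn (turn (turn (turn (turn i)))))} _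

closed₅ : ∀ {i j k l m} → Linked i j → Linked j k → Linked k l → Linked l m → Linked m i →
          i ≢ k → j ≢ l → k ≢ m → l ≢ i → m ≢ j → ⊥
closed₅ (inj₁ refl) jk kl lm mi i≢k j≢l k≢m l≢i _ = loop₅ jk kl lm mi i≢k j≢l k≢m l≢i
closed₅ (inj₂ refl) jk kl lm mi _ j≢l k≢m l≢i m≢j =
  loop₅ (linked-sym mi) (linked-sym lm) (linked-sym kl) (linked-sym jk)
    (≢-sym m≢j) (≢-sym l≢i) (≢-sym k≢m) (≢-sym j≢l)

linked-path : ∀ i j → Star Linked i j
linked-path i j = Star.reverse linked-sym (from-0F i) ◅◅ from-0F j
  where
  spin : ∀ k → Star Linked 0F (fold 0F turn k)
  spin zero    = Star.ε
  spin (suc k) = spin k ◅◅ return (inj₁ refl)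

  spin-toℕ : ∀ i → fold 0F turn (toℕ i) ≡ i
  spin-toℕ = toWitness {a? = all? λ i → fold 0F turn (toℕ i) ≟ i} _

  from-0F : ∀ i → Star Linked 0F i
  from-0F i = subst (Star Linked 0F) (spin-toℕ i) (spin (toℕ i))

-- Without colour `2F` the other two would alternate, so 0, 2, 4 and 6 would share a colour,
-- although 6 and 0 are linked.
third-colour : ∀ (c : Fin 7 → Fin 3) →
               (∀ {i j} → Linked i j → c i ≡ c j → c i ≡ 2F) →
               ∃[ i ] c i ≡ 2F
third-colour c proper with any? (λ i → c i ≟ 2F)
... | yes found = found
... | no ∄2F = contradiction (proper (inj₁ refl) c6≡c0) (λ eq → ∄2F (6F , eq))
  where
  other : ∀ (x y z : Fin 3) → x ≢ 2F → y ≢ 2F → z ≢ 2F → x ≢ y → y ≢ z → x ≡ z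
  other 0F 0F _  _ _ _ x≢y _ = contradiction refl x≢y
  other 0F 1F 0F _ _ _ _ _   = refl
  other 0F 1F 1F _ _ _ _ y≢z = contradiction refl y≢z
  other 1F 0F 0F _ _ _ _ y≢z = contradiction refl y≢z
  other 1F 0F 1F _ _ _ _ _   = refl
  other 1F 1F _  _ _ _ x≢y _ = contradiction refl x≢y
  other 2F _  _  x≢2 _ _ _ _ = contradiction refl x≢2
  other _  2F _  _ y≢2 _ _ _ = contradiction refl y≢2
  other _  _  2F _ _ z≢2 _ _ = contradiction refl z≢2

  alternate : ∀ i → c i ≡ c (turn (turn i))
  alternate i = other _ _ _ (∄2F ∘ (_ ,_)) (∄2F ∘ (_ ,_)) (∄2F ∘ (_ ,_))
    (λ eq → ∄2F (_ , proper (inj₁ refl) eq)) (λ eq → ∄2F (_ , proper (inj₁ refl) eq))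

  c6≡c0 : c 6F ≡ c 0F
  c6≡c0 = sym (trans (alternate 0F) (trans (alternate 2F) (alternate 4F)))

-- The graph

module Construction (T : ℕ) (sel : Fin T → Fin 7 → Fin 7) where

  -- The first component is a hub or a gadget; gadget t is attached to the hub
  -- i at its vertex sel t i.
  V : Set
  V = (Fin 7 ⊎ Fin T) × Fin 7

  pattern hub p a    = inj₁ p , a
  pattern gadget t i = inj₂ t , i

  V↔ : V ↔ Fin ((7 + T) * 7)
  V↔ = ↔-trans (↔-sym +↔⊎ ×-↔ ↔-refl) (↔-sym *↔×)

  Adj : V → V → Set
  Adj (hub p a) (hub q b)       = p ≡ q × Linked a b
  Adj (hub p a) (gadget t i)    = p ≡ i × a ≡ sel t i
  Adj (gadget t i) (hub p a)    = p ≡ i × a ≡ sel t i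
  Adj (gadget t i) (gadget u j) = t ≡ u × Linked i j

  adj? : Decidable Adj
  adj? (hub p a) (hub q b)       = (p ≟ q) ×-dec linked? a b
  adj? (hub p a) (gadget t i)    = (p ≟ i) ×-dec (a ≟ sel t i)
  adj? (gadget t i) (hub p a)    = (p ≟ i) ×-dec (a ≟ sel t i)
  adj? (gadget t i) (gadget u j) = (t ≟ u) ×-dec linked? i j

  adj-sym : Symmetric Adj
  adj-sym {hub _ _} {hub _ _} (eq , ab)       = sym eq , linked-sym ab
  adj-sym {hub _ _} {gadget _ _} adj          = adj
  adj-sym {gadget _ _} {hub _ _} adj          = adj
  adj-sym {gadget _ _} {gadget _ _} (eq , ij) = sym eq , linked-sym ij

  adj-irrefl : ∀ v → ¬ Adj v v
  adj-irrefl (hub _ a) (_ , aa)    = linked-irrefl a aa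
  adj-irrefl (gadget _ i) (_ , ii) = linked-irrefl i ii

  along : ∀ b {i j} → Linked i j → Adj (b , i) (b , j)
  along (inj₁ _) ij = refl , ij
  along (inj₂ _) ij = refl , ij

  open Transport V↔

  graph : Graph
  graph = record
    { order = (7 + T) * 7
    ; _∼_ = λ u v → Adj (from u) (from v)
    ; _∼?_ = λ u v → adj? (from u) (from v)
    ; ∼-sym = λ {u} {v} → adj-sym {from u} {from v}
    ; ∼-irrefl = λ v → adj-irrefl (from v)
    }


  -- Girth

  -- The cycle is turned so that its closing edge leads from a hub to a gadget. Only position `p` of
  -- a gadget is joined to hub `p`, so a stretch of gadget vertices that returns to the same hub
  -- would end where it began.
  cross₃ : ∀ {t i p a} v → Adj (gadget t i) v → Adj v (hub p a) →
           Adj (hub p a) (gadget t i) →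
           v ≢ hub p a → ⊥
  cross₃ (hub _ _) (refl , refl) _ (refl , refl) v≢ = v≢ refl
  cross₃ (gadget _ _) (refl , ij) (refl , _) (refl , _) _ = linked-irrefl _ ij

  cross₄ : ∀ {t i p a} v w → Adj (gadget t i) v → Adj v w → Adj w (hub p a) →
           Adj (hub p a) (gadget t i) →
           gadget t i ≢ w → v ≢ hub p a → ⊥
  cross₄ (hub _ _) _ (refl , refl) _ _ (refl , refl) _ v≢ = v≢ refl
  cross₄ (gadget _ _) (hub _ _) (refl , ij) (refl , _) (refl , _) (refl , _) _ _ =
    linked-irrefl _ ij
  cross₄ (gadget _ _) (gadget _ _) (refl , _) (refl , _) (refl , _) (refl , _) w≢ _ =
    w≢ refl

  cross₅ : ∀ {t i p a} v w x → Adj (gadget t i) v → Adj v w → Adj w x → Adj x (hub p a) →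
           Adj (hub p a) (gadget t i) →
           v ≢ hub p a → w ≢ hub p a → x ≢ gadget t i → gadget t i ≢ w → ⊥
  cross₅ (hub _ _) _ _ (refl , refl) _ _ _ (refl , refl) v≢ _ _ _ = v≢ refl
  cross₅ (gadget _ _) (hub _ _) (hub _ _)
    (refl , ij) (refl , _) (refl , _) (refl , _) (refl , _) _ _ _ _ = linked-irrefl _ ij
  -- Here `x` forms a stretch by itself, so its two hub neighbours coincide.
  cross₅ (gadget _ _) (hub _ _) (gadget _ _)
    _ _ (refl , refl) (refl , refl) _ _ w≢ _ _ = w≢ refl
  cross₅ (gadget _ _) (gadget _ _) (hub _ _)
    (refl , _) (refl , _) (refl , _) (refl , _) (refl , _) _ _ _ w≢ = w≢ refl
  cross₅ (gadget _ _) (gadget _ _) (gadget _ _)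
    (refl , _) (refl , _) (refl , _) (refl , _) (refl , _) _ _ x≢ _ = x≢ refl

  -- If both kinds of vertices occur, some hub vertex is followed by a gadget vertex, and the cycle
  -- is turned to close with that edge. Otherwise it stays within one 7-cycle.
  acyclic₃ : ∀ u v w → Adj u v → Adj v w → Adj w u → u ≢ w → v ≢ u → w ≢ v → ⊥
  acyclic₃ (gadget _ _) v (hub _ _) uv vw wu _ _ w≢v = cross₃ v uv vw wu (≢-sym w≢v)
  acyclic₃ (hub _ _) (gadget _ _) w uv vw wu u≢w _ _ = cross₃ w vw wu uv (≢-sym u≢w)
  acyclic₃ u (hub _ _) (gadget _ _) uv vw wu _ v≢u _ = cross₃ u wu uv vw (≢-sym v≢u)
  acyclic₃ (hub _ _) (hub _ _) (hub _ _) (refl , uv) (refl , vw) (_ , wu) u≢w v≢u w≢v =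
    closed₃ uv vw wu (u≢w ∘ cong (_ ,_)) (v≢u ∘ cong (_ ,_)) (w≢v ∘ cong (_ ,_))
  acyclic₃ (gadget _ _) (gadget _ _) (gadget _ _) (refl , uv) (refl , vw) (_ , wu) u≢w v≢u w≢v =
    closed₃ uv vw wu (u≢w ∘ cong (_ ,_)) (v≢u ∘ cong (_ ,_)) (w≢v ∘ cong (_ ,_))

  acyclic₄ : ∀ u v w x → Adj u v → Adj v w → Adj w x → Adj x u → u ≢ w → v ≢ x → ⊥
  acyclic₄ (gadget _ _) v w (hub _ _) uv vw wx xu u≢w v≢x = cross₄ v w uv vw wx xu u≢w v≢x
  acyclic₄ (hub _ _) (gadget _ _) w x uv vw wx xu u≢w v≢x = cross₄ w x vw wx xu uv v≢x (≢-sym u≢w)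
  acyclic₄ u (hub _ _) (gadget _ _) x uv vw wx xu u≢w v≢x =
    cross₄ x u wx xu uv vw (≢-sym u≢w) (≢-sym v≢x)
  acyclic₄ u v (hub _ _) (gadget _ _) uv vw wx xu u≢w v≢x = cross₄ u v xu uv vw wx (≢-sym v≢x) u≢w
  acyclic₄ (hub _ _) (hub _ _) (hub _ _) (hub _ _)
    (refl , uv) (refl , vw) (refl , wx) (_ , xu) u≢w v≢x =
    closed₄ uv vw wx xu (u≢w ∘ cong (_ ,_)) (v≢x ∘ cong (_ ,_))
  acyclic₄ (gadget _ _) (gadget _ _) (gadget _ _) (gadget _ _)
    (refl , uv) (refl , vw) (refl , wx) (_ , xu) u≢w v≢x =
    closed₄ uv vw wx xu (u≢w ∘ cong (_ ,_)) (v≢x ∘ cong (_ ,_))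

  acyclic₅ : ∀ u v w x y → Adj u v → Adj v w → Adj w x → Adj x y → Adj y u →
             u ≢ w → v ≢ x → w ≢ y → x ≢ u → y ≢ v → ⊥
  acyclic₅ (gadget _ _) v w x (hub _ _) uv vw wx xy yu u≢w v≢x w≢y x≢u y≢v =
    cross₅ v w x uv vw wx xy yu (≢-sym y≢v) w≢y x≢u u≢w
  acyclic₅ (hub _ _) (gadget _ _) w x y uv vw wx xy yu u≢w v≢x w≢y x≢u y≢v =
    cross₅ w x y vw wx xy yu uv (≢-sym u≢w) x≢u y≢v v≢x
  acyclic₅ u (hub _ _) (gadget _ _) x y uv vw wx xy yu u≢w v≢x w≢y x≢u y≢v =
    cross₅ x y u wx xy yu uv vw (≢-sym v≢x) y≢v u≢w w≢y
  acyclic₅ u v (hub _ _) (gadget _ _) y uv vw wx xy yu u≢w v≢x w≢y x≢u y≢v =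
    cross₅ y u v xy yu uv vw wx (≢-sym w≢y) u≢w v≢x x≢u
  acyclic₅ u v w (hub _ _) (gadget _ _) uv vw wx xy yu u≢w v≢x w≢y x≢u y≢v =
    cross₅ u v w yu uv vw wx xy (≢-sym x≢u) v≢x w≢y y≢v
  acyclic₅ (hub _ _) (hub _ _) (hub _ _) (hub _ _) (hub _ _)
    (refl , uv) (refl , vw) (refl , wx) (refl , xy) (_ , yu) u≢w v≢x w≢y x≢u y≢v =
    closed₅ uv vw wx xy yu (u≢w ∘ cong (_ ,_)) (v≢x ∘ cong (_ ,_)) (w≢y ∘ cong (_ ,_))
      (x≢u ∘ cong (_ ,_)) (y≢v ∘ cong (_ ,_))
  acyclic₅ (gadget _ _) (gadget _ _) (gadget _ _) (gadget _ _) (gadget _ _)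
    (refl , uv) (refl , vw) (refl , wx) (refl , xy) (_ , yu) u≢w v≢x w≢y x≢u y≢v =
    closed₅ uv vw wx xy yu (u≢w ∘ cong (_ ,_)) (v≢x ∘ cong (_ ,_)) (w≢y ∘ cong (_ ,_))
      (x≢u ∘ cong (_ ,_)) (y≢v ∘ cong (_ ,_))

  6≤length : ∀ l → HasCycleOfLength graph l → 6 ≤ l
  6≤length _ (m , refl , cycle) = long m cycle
    where
    distinct : ∀ {m} (cycle : CycleOn graph m) → let open CycleOn cycle in
               ∀ {i j} → i ≢ j → from (vertex i) ≢ from (vertex j)
    distinct cycle i≢j = i≢j ∘ CycleOn.injective cycle ∘ from-injective

    long : ∀ m → CycleOn graph m → 6 ≤ suc m
    long 0 cycle = contradiction (CycleOn.3≤length cycle) λ { (s≤s ()) }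
    long 1 cycle = contradiction (CycleOn.3≤length cycle) λ { (s≤s (s≤s ())) }
    long 2 cycle = ⊥-elim (acyclic₃ _ _ _ (step 0F) (step 1F) close
      (distinct cycle λ ()) (distinct cycle λ ()) (distinct cycle λ ()))
      where open CycleOn cycle
    long 3 cycle = ⊥-elim (acyclic₄ _ _ _ _ (step 0F) (step 1F) (step 2F) close
      (distinct cycle λ ()) (distinct cycle λ ()))
      where open CycleOn cycle
    long 4 cycle = ⊥-elim (acyclic₅ _ _ _ _ _ (step 0F) (step 1F) (step 2F) (step 3F) close
      (distinct cycle λ ()) (distinct cycle λ ()) (distinct cycle λ ())
      (distinct cycle λ ()) (distinct cycle λ ()))
      where open CycleOn cycle
    long (suc (suc (suc (suc (suc m))))) _ = s≤s (s≤s (s≤s (s≤s (s≤s (s≤s z≤n)))))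

  open Graph graph using (Vertex; _∼_)

  adj⇒∼ : ∀ {u v} → Adj u v → to u ∼ to v
  adj⇒∼ = subst₂ Adj (sym (strictlyInverseʳ _)) (sym (strictlyInverseʳ _))

  -- Gadgets with equal choices are joined to the same hub vertices, so their edges between
  -- positions 0 and 1 close up through hubs 0 and 1.
  module Hexagon {t u : Fin T} (t≢u : t ≢ u)
                 (same : ∀ i → sel t i ≡ sel u i) where

    corner : Fin 6 → V
    corner 0F = hub 0F (sel t 0F)
    corner 1F = gadget t 0F
    corner 2F = gadget t 1F
    corner 3F = hub 1F (sel t 1F)
    corner 4F = gadget u 1F
    corner 5F = gadget u 0F

    place : ∀ {w} → Dec (w ≡ t) → Fin 7 → Fin 6
    place (yes _) 0F = 1F
    place (yes _) _  = 2F
    place (no  _) 0F = 5F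
    place (no  _) _  = 4F

    -- A left inverse of `corner`, which makes the corners distinct; its values elsewhere are
    -- arbitrary.
    position : V → Fin 6
    position (hub 0F _)   = 0F
    position (hub _  _)   = 3F
    position (gadget w i) = place (w ≟ t) i

    position-corner : ∀ k → position (corner k) ≡ k
    position-corner 0F = refl
    position-corner 1F rewrite ≡-≟-identity _≟_ {t} refl = refl
    position-corner 2F rewrite ≡-≟-identity _≟_ {t} refl = refl
    position-corner 3F = refl
    position-corner 4F rewrite dec-no (u ≟ t) (≢-sym t≢u) = refl
    position-corner 5F rewrite dec-no (u ≟ t) (≢-sym t≢u) = refl

    step : ∀ k → Adj (corner (inject₁ k)) (corner (suc k))
    step 0F = refl , refl
    step 1F = refl , inj₁ refl
    step 2F = refl , refl
    step 3F = refl , same 1F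
    step 4F = refl , inj₂ refl

    hexagon : CycleOn graph 5
    hexagon = record
      { 3≤length  = s≤s (s≤s (s≤s z≤n))
      ; vertex    = to ∘ corner
      ; injective = λ {k} {l} eq → trans (sym (position-corner k))
          (trans (cong position (to-injective {corner k} {corner l} eq)) (position-corner l))
      ; step      = adj⇒∼ ∘ step
      ; close     = adj⇒∼ {corner 5F} {corner 0F} (refl , same 0F)
      }

  girth : ∀ {t u : Fin T} → t ≢ u → (∀ i → sel t i ≡ sel u i) → HasGirth graph 6
  girth t≢u same = (5 , refl , Hexagon.hexagon t≢u same) , 6≤length

  -- Embedding

  -- A 7-cycle has as many edges as vertices: `V` indexes the edges from a vertex to its `turn`, the
  -- other summand those between gadgets and hubs.
  Edge : Set
  Edge = V ⊎ (Fin T × Fin 7)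

  Edge↔ : Edge ↔ Fin ((7 + T) * 7 + T * 7)
  Edge↔ = ↔-trans (V↔ ⊎-↔ ↔-sym *↔×) (↔-sym +↔⊎)

  ends : Edge → Bool → V
  ends (inj₁ (b , i)) false = b , i
  ends (inj₁ (b , i)) true  = b , turn i
  ends (inj₂ (t , i)) false = gadget t i
  ends (inj₂ (t , i)) true  = hub i (sel t i)

  cover : ∀ u v → Adj u v → ∃[ e ] ∃[ b ] (ends e b ≡ u × ends e (not b) ≡ v)
  cover (hub p a) (hub _ b) (refl , inj₁ refl) = inj₁ (inj₁ p , a) , false , refl , refl
  cover (hub p a) (hub _ b) (refl , inj₂ refl) = inj₁ (inj₁ p , b) , true  , refl , refl
  cover (hub p a) (gadget t i) (refl , refl)   = inj₂ (t , i) , true  , refl , refl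
  cover (gadget t i) (hub p a) (refl , refl)   = inj₂ (t , i) , false , refl , refl
  cover (gadget t i) (gadget _ j) (refl , inj₁ refl) = inj₁ (inj₂ t , i) , false , refl , refl
  cover (gadget t i) (gadget _ j) (refl , inj₂ refl) = inj₁ (inj₂ t , j) , true  , refl , refl

  block-path : ∀ b {i j} → Star Adj (b , i) (b , j)
  block-path b = Star.gmap (b ,_) (along b) (linked-path _ _)

  -- Every gadget is joined to every hub, so any hub leads directly to gadget `t`.
  connected : ∀ t v → Star Adj v (gadget t 0F)
  connected t (hub p a) =
    block-path (inj₁ p) ◅◅ (refl , refl) ◅ block-path (inj₂ t) {p}
  connected t (gadget u i) = (refl , refl) ◅ connected t (hub i (sel u i))

  -- The edges of the 7-cycles cancel against the vertices in E - n + 1, leaving the `T * 7` joining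
  -- edges and 1.
  embeds : Fin T → graph EmbedsIn orientable (suc (T * 7))
  embeds t = thickening graph {h = suc (T * 7)} (λ e b → to (ends (E.from e) b))
    (λ {u} {v} u∼v → let e , b , eq₁ , eq₂ = cover (from u) (from v) u∼v in
      E.to e , b , end e b eq₁ , end e (not b) eq₂)
    (λ v → let b , i = from v in
      to (b , turn i) , subst (Adj _) (sym (strictlyInverseʳ _)) (along b (inj₁ refl)))
    (to (gadget t 0F))
    (λ v → conj-path adj⇒∼
      (subst (Star Adj _) (sym (strictlyInverseʳ _)) (connected t (from v))))
    (cong suc (ℕ.+-comm ((7 + T) * 7) (T * 7)))
    where
    module E = Inverse Edge↔
    end : ∀ e b {v} → ends e b ≡ from v → to (ends (E.from (E.to e)) b) ≡ v
    end e b {v} eq = trans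
      (cong (λ e → to (ends e b)) (E.strictlyInverseʳ e))
      (trans (cong to eq) (strictlyInverseˡ v))

  -- Colourings

  module _ {k q : ℕ} (copy : (Fin 7 → Fin 7) → Fin k → Fin T)
           (copy-injective : ∀ s → Injective _≡_ _≡_ (copy s))
           (sel-copy : ∀ s j i → sel (copy s j) i ≡ s i)
           (7q<k : 7 * q < k) {d : ℤ} (d≤q : d ℤ.≤ + q) where

    bound : Fin 3 → ℤ
    bound = 0ℤ ∷ 0ℤ ∷ d ∷ []

    not-colourable : ¬ Colourable graph bound
    not-colourable (c , small) =
      -- Two of the `k` gadgets with choice `s` share a slot. The slot determines the gadget vertex
      -- and hence the copy, against injectivity.
      let j , j′ , j<j′ , eq = pigeonhole 7q<k slot
          i≡i′ , index≡ = combine-injective (i j) _ (i j′) _ eq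
          u≡u′ = slot-determines (joined j) (joined j′) (few j) (few j′)
                   (cong (λ i → to (hub i (s i))) i≡i′) index≡
          copy≡ = cong proj₁ (to-injective {gadget (copy s j) (i j)}
                                           {gadget (copy s j′) (i j′)} u≡u′)
      in Fin.<⇒≢ j<j′ (copy-injective s (inj₂-injective copy≡))
      where
      like? : ∀ v → Decidable₁ (λ u → v ∼ u × c u ≡ c v)
      like? v u = Graph._∼?_ graph v u ×-dec (c u ≟ c v)

      sameColoured : Vertex → List Vertex
      sameColoured v = filter (like? v) (allFin _)

      member : ∀ {u v} → u ∼ v → c v ≡ c u → v ∈ sameColoured u
      member {u} {v} u∼v eq = ∈-filter⁺ (like? u) (∈-allFin v) (u∼v , eq)

      -- The colour is a separate variable `x` so that `bound x` computes once the colour is known.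
      degree : ∀ {v x} → c v ≡ x → + length (sameColoured v) ℤ.≤ bound x
      degree {v} refl = small v

      -- A neighbour of the same colour would have an index in a list of length 0.
      isolated : ∀ {u v x} → u ∼ v → c u ≡ x → x ≡ c v → ¬ bound x ℤ.≤ 0ℤ
      isolated u∼v cu≡x x≡cv bound≤0 =
        ¬Fin0 (inject≤ (index (member u∼v (sym (trans cu≡x x≡cv))))
                       (ℤ.drop‿+≤+ (ℤ.≤-trans (degree cu≡x) bound≤0)))

      proper : ∀ {u v} → u ∼ v → c u ≡ c v → c u ≡ 2F
      proper {u} u∼v eq with c u in cu
      ... | 0F = contradiction ℤ.≤-refl (isolated u∼v cu eq)
      ... | 1F = contradiction ℤ.≤-refl (isolated u∼v cu eq)
      ... | 2F = refl

      third : ∀ b → ∃[ i ] c (to (b , i)) ≡ 2F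
      third b = third-colour (λ i → c (to (b , i))) (λ ij → proper (adj⇒∼ (along b ij)))

      s : Fin 7 → Fin 7
      s i = proj₁ (third (inj₁ i))

      i : Fin k → Fin 7
      i j = proj₁ (third (inj₂ (copy s j)))

      hub-of gadget-of : Fin k → Vertex
      hub-of j    = to (hub (i j) (s (i j)))
      gadget-of j = to (gadget (copy s j) (i j))

      joined : ∀ j → gadget-of j ∈ sameColoured (hub-of j)
      joined j = member
        (adj⇒∼ {hub (i j) (s (i j))} {gadget (copy s j) (i j)}
          (refl , sym (sel-copy s j (i j))))
        (trans (proj₂ (third (inj₂ (copy s j)))) (sym (proj₂ (third (inj₁ (i j))))))

      few : ∀ j → length (sameColoured (hub-of j)) ≤ q
      few j = ℤ.drop‿+≤+ (ℤ.≤-trans (degree (proj₂ (third (inj₁ (i j))))) d≤q)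

      -- The slot of j determines hub-of j and then gadget-of j, by its position
      -- among the neighbours of hub-of j of the same colour.
      slot : Fin k → Fin (7 * q)
      slot j = combine (i j) (inject≤ (index (joined j)) (few j))

      slot-determines : ∀ {v v′ u u′} (u∈ : u ∈ sameColoured v) (u′∈ : u′ ∈ sameColoured v′) →
        ∀ le le′ → v ≡ v′ → inject≤ {n = q} (index u∈) le ≡ inject≤ (index u′∈) le′ → u ≡ u′
      slot-determines {v} u∈ u′∈ le le′ refl eq = trans (lookup-index u∈)
        (trans (cong (lookup (sameColoured v)) (inject≤-injective le le′ _ _ eq))
               (sym (lookup-index u′∈)))

-- The choice of ε

-- Since p < ⌊p⌋ + 1, also i < ⌊p⌋ + 1, which for integers means i ≤ ⌊p⌋.
floor-greatest : ∀ p i → i ℤ.* ↧ p ℤ.≤ ↥ p → i ℤ.≤ ℚ.floor p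
floor-greatest p@(mkℚ n d-1 _) i i≤p = begin
  i                                ≤⟨ ℤ.i<j⇒i≤pred[j] i<1+⌊p⌋ ⟩
  ℤ.pred (ℤ.suc (n ℤ./ℕ suc d-1))  ≡⟨ ℤ.pred-suc _ ⟩
  n ℤ./ℕ suc d-1                   ≡⟨ ℤ.div-pos-is-/ℕ n (suc d-1) ⟨
  ℚ.floor p                        ∎
  where
  open ℤ.≤-Reasoning
  i<1+⌊p⌋ : i ℤ.< ℤ.suc (n ℤ./ℕ suc d-1)
  i<1+⌊p⌋ = ℤ.*-cancelʳ-<-nonNeg (↧ p) (ℤ.≤-<-trans i≤p (ℤ.n<s[n/ℕd]*d n (suc d-1)))

ceiling-least : ∀ p i → ℚ.toℚᵘ p ℚᵘ.≤ ℚᵘ.mkℚᵘ i 0 → ceiling p ℤ.≤ i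
ceiling-least p@record{} i p≤i = begin
  ceiling p        ≤⟨ ℤ.neg-mono-≤ (floor-greatest (ℚ.- p) (ℤ.- i) -i≤-p) ⟩
  ℤ.- (ℤ.- i)      ≡⟨ ℤ.neg-involutive i ⟩
  i                ∎
  where
  open ℤ.≤-Reasoning
  -i≤-p : ℤ.- i ℤ.* ↧ (ℚ.- p) ℤ.≤ ↥ (ℚ.- p)
  -i≤-p = begin
    ℤ.- i ℤ.* ↧ (ℚ.- p)  ≡⟨ cong (ℤ.- i ℤ.*_) (ℚ.↧-neg p) ⟩
    ℤ.- i ℤ.* ↧ p        ≡⟨ ℤ.neg-distribˡ-* i (↧ p) ⟨
    ℤ.- (i ℤ.* ↧ p)      ≤⟨ ℤ.neg-mono-≤ (ℚᵘ.drop-*≤* p≤i) ⟩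
    ℤ.- (↥ p ℤ.* + 1)    ≡⟨ cong ℤ.-_ (ℤ.*-identityʳ (↥ p)) ⟩
    ℤ.- (↥ p)            ≡⟨ ℚ.↥-neg p ⟨
    ↥ (ℚ.- p)            ∎

1/[1+_] : ℕ → ℚ
1/[1+ d ] = mkℚ (+ 1) d (1-coprimeTo (suc d))

ceiling-quotient : ∀ d g q → g ≤ suc d * q → ceiling (1/[1+ d ] ℚ.* (+ g ℚ./ 1)) ℤ.≤ + q
ceiling-quotient d g q g≤ = ceiling-least p (+ q) p≤q
  where
  open ℤ.≤-Reasoning
  p = 1/[1+ d ] ℚ.* (+ g ℚ./ 1)

  p≤q : ℚ.toℚᵘ p ℚᵘ.≤ ℚᵘ.mkℚᵘ (+ q) 0
  p≤q = ℚᵘ.≤-trans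
    (ℚᵘ.≤-reflexive (ℚᵘ.≃-trans (ℚ.toℚᵘ-homo-* 1/[1+ d ] (+ g ℚ./ 1))
      (ℚᵘ.*-congˡ {ℚ.toℚᵘ 1/[1+ d ]} (ℚ.toℚᵘ-fromℚᵘ (ℚᵘ.mkℚᵘ (+ g) 0)))))
    (ℚᵘ.*≤* (begin
      + 1 ℤ.* + g ℤ.* + 1          ≡⟨ ℤ.*-identityʳ (+ 1 ℤ.* + g) ⟩
      + 1 ℤ.* + g                  ≡⟨ ℤ.*-identityˡ (+ g) ⟩
      + g                          ≤⟨ ℤ.+≤+ g≤ ⟩
      + (suc d * q)                ≡⟨ cong +_ (ℕ.*-comm (suc d) q) ⟩
      -- `suc (d * 1)` is what the denominator `suc d * 1` of the unnormalised product unfolds to.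
      + (q * suc d)                ≡⟨ cong (λ x → + (q * suc x)) (ℕ.*-identityʳ d) ⟨
      + (q * suc (d * 1))          ≡⟨ ℤ.pos-* q (suc (d * 1)) ⟩
      + q ℤ.* + suc (d * 1)        ∎))

-- S stands for 7 ^ 7; as a variable it keeps Fin (S * k) from unfolding.

module Family
  (S : ℕ) (encode : (Fin 7 → Fin 7) → Fin S) (decode : Fin S → Fin 7 → Fin 7)
  (decode-encode : ∀ s i → decode (encode s) i ≡ s i)
  where

  -- One more than `7 * q` for q = `suc N`. As q is positive, each choice has at least two copies,
  -- from which `girth` obtains a hexagon.
  k : ℕ → ℕ
  k N = suc (7 * suc N)

  copy : ∀ N → (Fin 7 → Fin 7) → Fin (k N) → Fin (S * k N)
  copy N s = combine (encode s)

  copy-injective : ∀ N s {j j′} → copy N s j ≡ copy N s j′ → j ≡ j′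
  copy-injective N s {j} {j′} = combine-injectiveʳ (encode s) j (encode s) j′

  sel : ∀ N → Fin (S * k N) → Fin 7 → Fin 7
  sel N t = decode (quotient (k N) t)

  sel-copy : ∀ N s j i → sel N (copy N s j) i ≡ s i
  sel-copy N s j i = trans
    (cong (λ (t , _) → decode t i) (remQuot-combine (encode s) j)) (decode-encode s i)

  handles genus : ℕ → ℕ
  handles N = suc (S * k N * 7)
  genus N   = 2 * handles N

  N<genus : ∀ N → N < genus N
  N<genus N = begin
    suc N               ≤⟨ ℕ.m≤n*m (suc N) 7 ⟩
    7 * suc N           ≤⟨ ℕ.n≤1+n _ ⟩
    k N                 ≤⟨ ℕ.m≤n*m (k N) S {{nonZeroIndex (encode λ _ → 0F)}} ⟩
    S * k N             ≤⟨ ℕ.m≤m*n (S * k N) 7 ⟩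
    S * k N * 7         ≤⟨ ℕ.n≤1+n _ ⟩
    suc (S * k N * 7)   ≤⟨ ℕ.m≤n*m _ 2 ⟩
    genus N             ∎
    where open ℕ.≤-Reasoning

  -- The genus is affine in `N`, with value 2 + 112 S at 0 and slope 98 S. The term added in the
  -- first step raises the slope to that value, whose reciprocal is `scale`; hence `scale` times the
  -- genus is at most `suc N`.
  genus-linear : ∀ N → genus N ≤ suc (1 + 112 * S) * suc N
  genus-linear N = begin
    genus N                               ≤⟨ ℕ.m≤m+n (genus N) _ ⟩
    genus N + (2 + 14 * S) * N            ≡⟨ solve 2 (λ S N →
      con 2 :* (con 1 :+ S :* (con 1 :+ con 7 :* (con 1 :+ N)) :* con 7)
        :+ (con 2 :+ con 14 :* S) :* N
      := (con 2 :+ con 112 :* S) :* (con 1 :+ N)) refl S N ⟩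
    suc (1 + 112 * S) * suc N             ∎
    where
    open ℕ.≤-Reasoning
    open ℕ-Solver.+-*-Solver

  graph : ℕ → Graph
  graph N = Construction.graph (S * k N) (sel N)

  girth : ∀ N → HasGirth (graph N) 6
  girth N = Construction.girth _ (sel N)
    ((λ ()) ∘ copy-injective N (λ _ → 0F) {0F} {1F})
    (λ i → trans (sel-copy N _ 0F i) (sym (sel-copy N _ 1F i)))

  embeds : ∀ N → graph N EmbedsIn orientable (handles N)
  embeds N = Construction.embeds _ (sel N) (copy N (λ _ → 0F) 0F)

  scale : ℚ
  scale = 1/[1+ 1 + 112 * S ]

  not-colourable : ∀ N →
    ¬ Colourable (graph N) (0ℤ ∷ 0ℤ ∷ ceiling (scale ℚ.* (+ genus N ℚ./ 1)) ∷ [])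
  not-colourable N = Construction.not-colourable _ (sel N)
    (copy N) (λ s → copy-injective N s) (sel-copy N) (ℕ.n<1+n _)
    (ceiling-quotient (1 + 112 * S) (genus N) (suc N) (genus-linear N))

mainTheorem11 : ∃[ ε ] (0ℚ ℚ.< ε ×
    (∀ (N : ℕ) → ∃[ g ] (N < g ×
    (∃[ G ]
    (HasGirth G 6 ×
    (∃[ S ] (eulerGenus S ≡ g × G EmbedsIn S)) ×
    ¬ Colourable G (0ℤ ∷ 0ℤ ∷ ceiling (ε ℚ.* (+ g ℚ./ 1)) ∷ []))))))
mainTheorem11 = F.scale , ℚ.positive⁻¹ F.scale , λ N →
  F.genus N , F.N<genus N , F.graph N , F.girth N ,
  (orientable (F.handles N) , refl , F.embeds N) , F.not-colourable N
  where module F = Family (7 ^ 7) funToFin finToFun finToFun-funToFin
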